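{- For all integers $n \ge 2$, we have $p_{n-1}+p_n \ge p_{n+1}$. Equality holds only for $n=2$.
   Context: For each integer $n \ge 1$, $p_n$ denotes the $n$th prime number, so $p_1=2$, $p_2=3$, $p_3=5$, and so on. -}

module Defs where

open import Data.Nat.Base
open import Data.Nat.Divisibility using (_∣_; ∣m+n∣m⇒∣n; ∣1⇒≡1; ∣-trans; m∣m*n; m≤n⇒m!∣n!)
open import Data.Nat.ListAction using (product)
open import Data.Nat.Primality using (Prime; prime?; prime⇒nonZero; prime⇒nonTrivial)
open import Data.Nat.Primality.Factorisation using (PrimeFactorisation; factorise)
open import Data.Nat.Properties
open import Data.List.Base using ([]; _∷_)
open import Data.List.Relation.Unary.All using (_∷_)
open import Data.Product.Base using (∃; _×_; _,_; proj₁; proj₂)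
open import Data.Sum.Base using (inj₁; inj₂)
open import Relation.Binary.PropositionalEquality using (_≡_; refl; sym; trans; subst)
open import Relation.Nullary using (yes; no; contradiction)

infix 4 _IsNextPrimeAfter_

record _IsNextPrimeAfter_ (q m : ℕ) : Set where
  field
    prime   : Prime q
    exceeds : m < q
    least   : ∀ {r} → Prime r → m < r → q ≤ r

open _IsNextPrimeAfter_ public

primeDivisor : ∀ n → 1 < n → ∃ λ q → Prime q × q ∣ n
primeDivisor n 1<n with factorise n {{>-nonZero (<-trans z<s 1<n)}}
... | record { factors = [] ; isFactorisation = n≡1 } =
  contradiction (sym n≡1) (<⇒≢ 1<n)
... | record { factors = q ∷ qs ; isFactorisation = n≡q*qs ; factorsPrime = pq ∷ _ } =
  q , pq , subst (q ∣_) (sym n≡q*qs) (m∣m*n (product qs))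

n∣n! : ∀ n → .{{NonZero n}} → n ∣ n !
n∣n! (suc n) = m∣m*n (n !)

-- Euclid: a prime divisor of m ! + 1 exceeds m.
primes-unbounded : ∀ m → ∃ λ q → Prime q × m < q
primes-unbounded m with primeDivisor (m ! + 1) (+-monoˡ-≤ 1 (1≤n! m))
... | q , pq , q∣m!+1 = q , pq , ≰⇒> λ q≤m →
  contradiction
    (∣1⇒≡1 (∣m+n∣m⇒∣n q∣m!+1
      (∣-trans (n∣n! q {{prime⇒nonZero pq}}) (m≤n⇒m!∣n! q≤m))))
    (nonTrivial⇒≢1 {{prime⇒nonTrivial pq}})

nextPrime : ∀ m → ∃ λ q → q IsNextPrimeAfter m
nextPrime m with primes-unbounded m
... | b , pb , m<b = search (b ∸ suc m) (suc m) ≤-refl (m+[n∸m]≡n m<b) λ _ m<r → m<r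
  where
  search : ∀ k s → m < s → s + k ≡ b → (∀ {r} → Prime r → m < r → s ≤ r) →
           ∃ λ q → q IsNextPrimeAfter m
  search zero s m<s s+0≡b lb = s , record
    { prime   = subst Prime (trans (sym s+0≡b) (+-identityʳ s)) pb
    ; exceeds = m<s
    ; least   = lb
    }
  search (suc k) s m<s s+1+k≡b lb with prime? s
  ... | yes ps = s , record { prime = ps ; exceeds = m<s ; least = lb }
  ... | no ¬ps = search k (suc s) (m<n⇒m<1+n m<s) (trans (sym (+-suc s k)) s+1+k≡b)
    λ {r} pr m<r → ≤∧≢⇒< (lb pr m<r) λ s≡r → ¬ps (subst Prime (sym s≡r) pr)

-- p n is the n-th prime, counted from 1; p 0 = 0 is not a prime, only the
-- starting value of the recursion.
p : ℕ → ℕ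
p zero    = 0
p (suc n) = proj₁ (nextPrime (p n))

p-isNextPrime : ∀ n → p (suc n) IsNextPrimeAfter p n
p-isNextPrime n = proj₂ (nextPrime (p n))

p-surjective : ∀ {q} → Prime q → ∃ λ n → p (suc n) ≡ q
p-surjective {q} pq = go q (n≤p q)
  where
  n≤p : ∀ n → n ≤ p n
  n≤p zero    = z≤n
  n≤p (suc n) = ≤-trans (s≤s (n≤p n)) (exceeds (p-isNextPrime n))

  go : ∀ k → q ≤ p k → ∃ λ n → p (suc n) ≡ q
  go zero    q≤0 = contradiction q≤0 (<⇒≱ (>-nonZero⁻¹ q {{prime⇒nonZero pq}}))
  go (suc k) q≤p with ≤-<-connex q (p k)
  ... | inj₁ q≤pk = go k q≤pk
  ... | inj₂ pk<q = k , ≤-antisym (least (p-isNextPrime k) pq pk<q) q≤p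

p₁≡2 : p 1 ≡ 2
p₁≡2 = refl

p₂≡3 : p 2 ≡ 3
p₂≡3 = refl

p₃≡5 : p 3 ≡ 5
p₃≡5 = refl

{-# OPTIONS --safe #-}

-- Since p n > p (n ∸ 1), it suffices that for x ≥ 6 there are two primes between x and 2 x. This is
-- Erdős's proof of Bertrand's postulate with one more factor 2 x. Suppose that y is the only prime
-- in (x , 2 x], and let B = (2 x) C x. A prime power dividing B is at most 2 x, so a prime q with
-- q² > 2 x divides B at most once; no prime in (2 x / 3 , x] divides B. With primorial n ≤ 4 ^ n and
-- s² > 2 x this gives 4 ^ x ≤ 2 x B ≤ 2 x · (2 x) ^ s · 4 ^ (2 x / 3) · 2 x, which is false for
-- x ≥ 8192. Below that, a chain of pairs of primes suffices.
--
-- The bound on prime powers avoids Legendre's formula: by the recurrence of Leibniz's harmonic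
-- triangle, i * (m C i) divides every common multiple of 1 , … , m.

module Submission where

open import Defs
open import Data.Nat.Base
  using ( ℕ; zero; suc; _+_; _*_; _∸_; _^_; _!; pred; _≤_; _<_; _≥_; z≤n; s≤s; s≤s⁻¹; z<s; ⌊_/2⌋; ⌈_/2⌉
        ; NonZero; >-nonZero; ≢-nonZero⁻¹; n>1⇒nonTrivial; nonTrivial⇒n>1; nonTrivial⇒≢1)
open import Data.Nat.Combinatorics
  using (_C_; nCk≡n!/k![n-k]!; k![n∸k]!∣n!; nCk+nC[k+1]≡[n+1]C[k+1])
open import Data.Nat.DivMod using (_/_; _%_; m/n*n≡m; m/n*n≤m; m%n<n; m≡m%n+[m/n]*n)
open import Data.Nat.Divisibility
open import Data.Nat.Divisibility.Core using (hasNonTrivialDivisor)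
open import Data.Nat.Induction using (<-rec)
open import Data.Nat.Primality hiding (prime)
open import Data.Nat.Properties
open import Data.Nat.Tactic.RingSolver using (solve-∀)
open import Data.Product.Base using (∃; ∃₂; _×_; _,_; proj₁; proj₂)
open import Data.Sum.Base using (inj₁; inj₂; [_,_]′)
open import Function.Base using (_∘_)
open import Function.Bundles using (_⇔_; mk⇔)
open import Relation.Binary.PropositionalEquality
  using (_≡_; refl; sym; trans; cong; cong₂; subst; subst₂; module ≡-Reasoning)
open import Relation.Nullary using (¬_; yes; no; contradiction; from-yes)
open import Relation.Nullary.Decidable using (True; toWitness)

-- Valuations and primes in factorials

1<prime : ∀ {q} → Prime q → 1 < q
1<prime pq = nonTrivial⇒n>1 _ {{prime⇒nonTrivial pq}}

-- Divide by `q` as long as possible. The base is any `q` above 1, because `sift` applies this to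
-- every integer of an interval.
valuation : ∀ {q} → 1 < q → ∀ n → .{{NonZero n}} → ∃₂ λ k m → n ≡ q ^ k * m × q ∤ m
valuation {q} 1<q n {{n≢0}} =
  <-rec (λ n → NonZero n → ∃₂ λ k m → n ≡ q ^ k * m × q ∤ m) go n (>-nonZero (n≢0⇒n>0 (≢-nonZero⁻¹ n)))
  where
  go : ∀ n → (∀ {m} → m < n → NonZero m → ∃₂ λ k m′ → m ≡ q ^ k * m′ × q ∤ m′) →
       NonZero n → ∃₂ λ k m → n ≡ q ^ k * m × q ∤ m
  go n rec n≢0 with q ∣? n
  ... | no q∤n = 0 , n , sym (*-identityˡ n) , q∤n
  ... | yes q∣n with rec (quotient-< q∣n {{n>1⇒nonTrivial 1<q}} {{n≢0}}) (quotient≢0 q∣n {{n≢0}})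
  ...   | k , m , eq , q∤m = suc k , m , (begin
      n                ≡⟨ m∣n⇒n≡m*quotient q∣n ⟩
      q * quotient q∣n ≡⟨ cong (q *_) eq ⟩
      q * (q ^ k * m)  ≡⟨ *-assoc q (q ^ k) m ⟨
      q ^ suc k * m    ∎) , q∤m
    where open ≡-Reasoning

-- Euclid's lemma finds one factor `q` in `b`; cancel it and repeat.
prime^∣*⇒prime^∣ : ∀ {q a} → Prime q → q ∤ a → ∀ k {b} → q ^ k ∣ a * b → q ^ k ∣ b
prime^∣*⇒prime^∣ pq q∤a zero {b} _ = 1∣ b
prime^∣*⇒prime^∣ {q} {a} pq q∤a (suc k) {b} q^∣ab
  with euclidsLemma a b pq (m*n∣⇒m∣ q (q ^ k) q^∣ab)
... | inj₁ q∣a = contradiction q∣a q∤a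
... | inj₂ (divides c refl) = subst (q ^ suc k ∣_) (*-comm q c)
  (*-monoʳ-∣ q (prime^∣*⇒prime^∣ pq q∤a k
    (*-cancelˡ-∣ q {{prime⇒nonZero pq}} (subst (q ^ suc k ∣_) (shuffle a c q) q^∣ab))))
  where
  shuffle : ∀ a c q → a * (c * q) ≡ q * (a * c)
  shuffle = solve-∀

prime^∣prime*⇒prime^∣ : ∀ {q} → Prime q → ∀ k {n} → q ^ suc k ∣ q * n → q ^ k ∣ n
prime^∣prime*⇒prime^∣ {q} pq k = *-cancelˡ-∣ q {{prime⇒nonZero pq}}

-- The multiples of `q` among the factors are `q`, ..., `c * q`, and `c < q` makes each contain `q`
-- only once. The induction strips the top factor: it is prime to `q` if `r > 0`; if `r = 0` it
-- gives up one `q`, and the remainder restarts at `pred q`.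
prime^∤! : ∀ {q} → Prime q → ∀ c r → c < q → r < q → q ^ suc c ∤ (c * q + r) !
prime^∤! {q} pq zero zero _ _ q∣1 =
  contradiction (∣1⇒≡1 (m*n∣⇒m∣ q 1 q∣1)) (nonTrivial⇒≢1 {{prime⇒nonTrivial pq}})
prime^∤! {q} pq (suc c) zero c<q _ q^∣ = prime^∤! pq c (pred q) (<⇒≤ c<q) (≤-reflexive suc[pred])
  (prime^∣*⇒prime^∣ pq (>⇒∤ c<q) (suc c)
    (prime^∣prime*⇒prime^∣ pq (suc c) (subst (q ^ suc (suc c) ∣_) unfold q^∣)))
  where
  suc[pred] : suc (pred q) ≡ q
  suc[pred] = suc-pred q {{prime⇒nonZero pq}}
  unfold : (suc c * q + 0) ! ≡ q * (suc c * (c * q + pred q) !)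
  unfold = begin
    (suc c * q + 0) !                    ≡⟨ cong _! index ⟩
    suc (c * q + pred q) * (c * q + pred q) ! ≡⟨ cong (_* (c * q + pred q) !) (trans (sym index) (+-identityʳ (suc c * q))) ⟩
    suc c * q * (c * q + pred q) !       ≡⟨ shuffle (suc c) q ((c * q + pred q) !) ⟩
    q * (suc c * (c * q + pred q) !)     ∎
    where
    open ≡-Reasoning
    shuffle : ∀ a q f → a * q * f ≡ q * (a * f)
    shuffle = solve-∀
    index : suc c * q + 0 ≡ suc (c * q + pred q)
    index = begin
      suc c * q + 0        ≡⟨ +-identityʳ (suc c * q) ⟩
      q + c * q            ≡⟨ +-comm q (c * q) ⟩
      c * q + q            ≡⟨ cong (c * q +_) suc[pred] ⟨
      c * q + suc (pred q) ≡⟨ +-suc (c * q) (pred q) ⟩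
      suc (c * q + pred q) ∎
prime^∤! {q} pq c (suc r) c<q r<q q^∣ = prime^∤! pq c r c<q (<⇒≤ r<q)
  (prime^∣*⇒prime^∣ pq q∤ (suc c) (subst (λ n → q ^ suc c ∣ n !) (+-suc (c * q) r) q^∣))
  where
  q∤ : q ∤ suc (c * q + r)
  q∤ q∣ = >⇒∤ r<q (∣m+n∣m⇒∣n (subst (q ∣_) (sym (+-suc (c * q) r)) q∣) (n∣m*n c))

prime∤! : ∀ {q m} → Prime q → m < q → q ∤ m !
prime∤! {q} {m} pq m<q q∣m! =
  prime^∤! pq 0 m (<⇒≤ (1<prime pq)) m<q (subst (_∣ m !) (sym (*-identityʳ q)) q∣m!)

prime∣! : ∀ {q m} → Prime q → q ≤ m → q ∣ m !
prime∣! {q} pq q≤m = ∣-trans (n∣n! q {{prime⇒nonZero pq}}) (m≤n⇒m!∣n! q≤m)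

-- Binomial coefficients

-- Multiplied out and with upper index `a + b`, the factorial formula is free of division and
-- subtraction.
binomial-! : ∀ a b → ((a + b) C a) * (a ! * b !) ≡ (a + b) !
binomial-! a b = begin
  ((a + b) C a) * (a ! * b !)
    ≡⟨ cong (λ c → ((a + b) C a) * (a ! * c !)) (m+n∸m≡n a b) ⟨
  ((a + b) C a) * (a ! * (a + b ∸ a) !)
    ≡⟨ cong (_* (a ! * (a + b ∸ a) !)) (nCk≡n!/k![n-k]! (m≤m+n a b)) ⟩
  (a + b) ! / (a ! * (a + b ∸ a) !) * (a ! * (a + b ∸ a) !)
    ≡⟨ m/n*n≡m (k![n∸k]!∣n! (m≤m+n a b)) ⟩
  (a + b) ! ∎
  where
  open ≡-Reasoning
  instance _ = a !* (a + b ∸ a) !≢0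

binomial≢0 : ∀ a b → NonZero ((a + b) C a)
binomial≢0 a b = m*n≢0⇒m≢0 ((a + b) C a) {{subst NonZero (sym (binomial-! a b)) ((a + b) !≢0)}}

-- This is half the row sum; `primorial≤4^` needs the factor 2 saved here when `n` is odd.
binomial≤2^ : ∀ n k → suc n C k ≤ 2 ^ n
binomial≤2^ n       zero          = m^n>0 2 n
binomial≤2^ zero    (suc zero)    = ≤-refl
binomial≤2^ zero    (suc (suc k)) = z≤n
binomial≤2^ (suc n) (suc k) = begin
  suc (suc n) C suc k         ≡⟨ nCk+nC[k+1]≡[n+1]C[k+1] (suc n) k ⟨
  suc n C k + suc n C suc k   ≤⟨ +-mono-≤ (binomial≤2^ n k) (binomial≤2^ n (suc k)) ⟩
  2 ^ n + 2 ^ n               ≡⟨ cong (2 ^ n +_) (+-identityʳ (2 ^ n)) ⟨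
  2 ^ suc n                   ∎
  where open ≤-Reasoning

centralBinomial-step : ∀ n →
  suc n * ((suc n + suc n) C suc n) ≡ 2 * suc (n + n) * ((n + n) C n)
centralBinomial-step n = *-cancelʳ-≡ _ _ (suc n * (n ! * n !))
  {{m*n≢0 (suc n) (n ! * n !) {{_}} {{n !* n !≢0}}}} (begin
    suc n * B′ * (suc n * (n ! * n !))            ≡⟨ left n B′ (n !) ⟩
    B′ * (suc n ! * suc n !)                      ≡⟨ binomial-! (suc n) (suc n) ⟩
    (suc n + suc n) !                             ≡⟨ cong (λ m → suc m !) (+-suc n n) ⟩
    suc (suc (n + n)) * (suc (n + n) * (n + n) !) ≡⟨ cong (λ f → suc (suc (n + n)) * (suc (n + n) * f)) (binomial-! n n) ⟨
    suc (suc (n + n)) * (suc (n + n) * (B * (n ! * n !))) ≡⟨ right n B (n !) ⟩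
    2 * suc (n + n) * B * (suc n * (n ! * n !))   ∎)
  where
  open ≡-Reasoning
  B  = (n + n) C n
  B′ = (suc n + suc n) C suc n
  left : ∀ n b f → suc n * b * (suc n * (f * f)) ≡ b * ((suc n * f) * (suc n * f))
  left = solve-∀
  right : ∀ n b f → suc (suc (n + n)) * (suc (n + n) * (b * (f * f))) ≡
                    2 * suc (n + n) * b * (suc n * (f * f))
  right = solve-∀

-- By `centralBinomial-step`, passing from `n` to `n + 1` multiplies the right side by 4 (2 n + 1) /
-- (2 n), which is more than 4.
4^n≤2n*centralBinomial : ∀ n → .{{NonZero n}} → 4 ^ n ≤ (n + n) * ((n + n) C n)
4^n≤2n*centralBinomial 1 = ≤-refl
4^n≤2n*centralBinomial (suc n@(suc _)) = begin
  4 * 4 ^ n                                 ≤⟨ *-monoʳ-≤ 4 (4^n≤2n*centralBinomial n) ⟩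
  4 * ((n + n) * B)                         ≤⟨ *-monoʳ-≤ 4 (*-monoˡ-≤ B (n≤1+n (n + n))) ⟩
  4 * (suc (n + n) * B)                     ≡⟨ regroup n B ⟩
  2 * (2 * suc (n + n) * B)                 ≡⟨ cong (2 *_) (centralBinomial-step n) ⟨
  2 * (suc n * ((suc n + suc n) C suc n))   ≡⟨ regroup′ n ((suc n + suc n) C suc n) ⟩
  (suc n + suc n) * ((suc n + suc n) C suc n) ∎
  where
  open ≤-Reasoning
  B = (n + n) C n
  regroup : ∀ n b → 4 * (suc (n + n) * b) ≡ 2 * (2 * suc (n + n) * b)
  regroup = solve-∀
  regroup′ : ∀ n b → 2 * (suc n * b) ≡ (suc n + suc n) * b
  regroup′ = solve-∀

-- Prime powers dividing binomial coefficients

-- The reciprocal of an entry of Leibniz's harmonic triangle.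
leibniz : ℕ → ℕ → ℕ
leibniz i b = suc i * ((suc i + b) C suc i)

leibniz-! : ∀ i b → leibniz i b * (i ! * b !) ≡ (suc i + b) !
leibniz-! i b = trans (shuffle i ((suc i + b) C suc i) (i !) (b !)) (binomial-! (suc i) b)
  where
  shuffle : ∀ i c f g → suc i * c * (f * g) ≡ c * ((suc i * f) * g)
  shuffle = solve-∀

-- Together with `leibniz-stepˡ` this gives the harmonic recurrence, since `suc i` and `suc b` add
-- up to `suc (suc i + b)`.
leibniz-stepʳ : ∀ i b → suc b * leibniz i (suc b) ≡ suc (suc i + b) * leibniz i b
leibniz-stepʳ i b = *-cancelʳ-≡ _ _ (i ! * b !) {{i !* b !≢0}} (begin
  suc b * leibniz i (suc b) * (i ! * b !)     ≡⟨ left b (leibniz i (suc b)) (i !) (b !) ⟩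
  leibniz i (suc b) * (i ! * suc b !)         ≡⟨ leibniz-! i (suc b) ⟩
  (suc i + suc b) !                           ≡⟨ cong _! (+-suc (suc i) b) ⟩
  suc (suc i + b) * (suc i + b) !             ≡⟨ cong (suc (suc i + b) *_) (leibniz-! i b) ⟨
  suc (suc i + b) * (leibniz i b * (i ! * b !)) ≡⟨ *-assoc (suc (suc i + b)) (leibniz i b) (i ! * b !) ⟨
  suc (suc i + b) * leibniz i b * (i ! * b !) ∎)
  where
  open ≡-Reasoning
  left : ∀ b l f g → suc b * l * (f * g) ≡ l * (f * (suc b * g))
  left = solve-∀

leibniz-stepˡ : ∀ i b → suc i * leibniz (suc i) b ≡ suc (suc i + b) * leibniz i b
leibniz-stepˡ i b = *-cancelʳ-≡ _ _ (i ! * b !) {{i !* b !≢0}} (begin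
  suc i * leibniz (suc i) b * (i ! * b !)     ≡⟨ left i (leibniz (suc i) b) (i !) (b !) ⟩
  leibniz (suc i) b * (suc i ! * b !)         ≡⟨ leibniz-! (suc i) b ⟩
  suc (suc i + b) * (suc i + b) !             ≡⟨ cong (suc (suc i + b) *_) (leibniz-! i b) ⟨
  suc (suc i + b) * (leibniz i b * (i ! * b !)) ≡⟨ *-assoc (suc (suc i + b)) (leibniz i b) (i ! * b !) ⟨
  suc (suc i + b) * leibniz i b * (i ! * b !) ∎)
  where
  open ≡-Reasoning
  left : ∀ i l f g → suc i * l * (f * g) ≡ l * ((suc i * f) * g)
  left = solve-∀

-- In Leibniz's triangle 1/y = 1/z − 1/x for y the entry at (i + 1, b), z the one at (i, b)
-- and x the one at (i, b + 1), so if x and z divide L then so does y.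
leibniz∣ : ∀ i b L → (∀ j → 1 ≤ j → j ≤ suc i + b → j ∣ L) → leibniz i b ∣ L
leibniz∣ zero b L j∣L = subst (_∣ L) (sym (*-cancelʳ-≡ _ _ (b !) {{b !≢0}} (begin
  leibniz 0 b * b !        ≡⟨ cong (leibniz 0 b *_) (+-identityʳ (b !)) ⟨
  leibniz 0 b * (0 ! * b !) ≡⟨ leibniz-! 0 b ⟩
  suc b * b !              ∎))) (j∣L (suc b) (s≤s z≤n) ≤-refl)
  where open ≡-Reasoning
leibniz∣ (suc i) b L j∣L = ∣m+n∣m⇒∣n {m = y * u} {n = L}
  (subst (y ∣_) (trans y*w≡ (+-comm L (y * u))) (m∣m*n w)) (m∣m*n u)
  where
  x = leibniz i (suc b)
  y = leibniz (suc i) b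
  z = leibniz i b
  S = suc (suc i + b)
  x∣L : x ∣ L
  x∣L = leibniz∣ i (suc b) L λ j 1≤j j≤ → j∣L j 1≤j (≤-trans j≤ (≤-reflexive (+-suc (suc i) b)))
  z∣L : z ∣ L
  z∣L = leibniz∣ i b L λ j 1≤j j≤ → j∣L j 1≤j (m≤n⇒m≤1+n j≤)
  u = quotient x∣L
  w = quotient z∣L
  -- As `L` is both `x * u` and `z * w`, this is 1/y = 1/z - 1/x multiplied by `y * L`, with the
  -- negative term moved across.
  y*w≡ : y * w ≡ L + y * u
  y*w≡ = *-cancelˡ-≡ _ _ (suc i) (begin
    suc i * (y * w)               ≡⟨ *-assoc (suc i) y w ⟨
    suc i * y * w                 ≡⟨ cong (_* w) (leibniz-stepˡ i b) ⟩
    S * z * w                     ≡⟨ *-assoc S z w ⟩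
    S * (z * w)                   ≡⟨ cong (S *_) (m∣n⇒n≡m*quotient z∣L) ⟨
    S * L                         ≡⟨ split i b L ⟩
    suc i * L + suc b * L         ≡⟨ cong (λ l → suc i * L + suc b * l) (m∣n⇒n≡m*quotient x∣L) ⟩
    suc i * L + suc b * (x * u)   ≡⟨ cong (suc i * L +_) (*-assoc (suc b) x u) ⟨
    suc i * L + suc b * x * u     ≡⟨ cong (λ l → suc i * L + l * u) (leibniz-stepʳ i b) ⟩
    suc i * L + S * z * u         ≡⟨ cong (λ l → suc i * L + l * u) (leibniz-stepˡ i b) ⟨
    suc i * L + suc i * y * u     ≡⟨ merge i L y u ⟩
    suc i * (L + y * u)           ∎)
    where
    open ≡-Reasoning
    split : ∀ i b l → suc (suc i + b) * l ≡ suc i * l + suc b * l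
    split = solve-∀
    merge : ∀ i l y u → suc i * l + suc i * y * u ≡ suc i * (l + y * u)
    merge = solve-∀

-- `M` is the product of the parts of 1, ..., `m` prime to `q`. Each of these numbers is below
-- `q ^ suc k`, so its power of `q` divides `q ^ k`.
commonMultiple : ∀ {q} → Prime q → ∀ k m → m < q ^ suc k →
                 ∃ λ M → q ∤ M × (∀ i → 1 ≤ i → i ≤ m → i ∣ q ^ k * M)
commonMultiple pq k zero _ = 1 , >⇒∤ (1<prime pq) , λ i 1≤i i≤0 → contradiction (≤-trans 1≤i i≤0) λ ()
commonMultiple {q} pq k (suc m) m<q^
  with commonMultiple pq k m (<-trans (n<1+n m) m<q^) | valuation (1<prime pq) (suc m)
... | M , q∤M , i∣ | a , c , eq , q∤c = M * c , q∤M*c , divides-all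
  where
  instance
    q≢0 : NonZero q
    q≢0 = prime⇒nonZero pq
    c≢0 : NonZero c
    c≢0 = m*n≢0⇒n≢0 (q ^ a) {{subst NonZero eq _}}
  q∤M*c : q ∤ M * c
  q∤M*c q∣ = [ q∤M , q∤c ]′ (euclidsLemma M c pq q∣)
  a≤k : a ≤ k
  a≤k = ≮⇒≥ λ k<a → <⇒≱ m<q^ (≤-trans (^-monoʳ-≤ q k<a)
    (≤-trans (m≤m*n (q ^ a) c) (≤-reflexive (sym eq))))
  q^a∣q^k : q ^ a ∣ q ^ k
  q^a∣q^k = divides (q ^ (k ∸ a)) (trans (cong (q ^_) (sym (m∸n+n≡m a≤k))) (^-distribˡ-+-* q (k ∸ a) a))
  divides-all : ∀ i → 1 ≤ i → i ≤ suc m → i ∣ q ^ k * (M * c)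
  divides-all i 1≤i i≤1+m with m≤n⇒m<n∨m≡n i≤1+m
  ... | inj₁ (s≤s i≤m) = ∣-trans (i∣ i 1≤i i≤m) (*-monoʳ-∣ (q ^ k) (m∣m*n c))
  ... | inj₂ refl = subst (_∣ q ^ k * (M * c)) (sym eq) (*-pres-∣ q^a∣q^k (n∣m*n M))

-- If `q ^ suc k` exceeded `a + b`, the binomial coefficient would divide a common multiple
-- `q ^ k * M` with `q ∤ M`, which has no room for `q ^ suc k`.
prime^∣binomial⇒≤ : ∀ {q} → Prime q → ∀ k a b → .{{NonZero a}} →
                    q ^ k ∣ (a + b) C a → q ^ k ≤ a + b
prime^∣binomial⇒≤ pq zero    (suc i) b _  = s≤s z≤n
prime^∣binomial⇒≤ {q} pq (suc k) (suc i) b q^∣ = ≮⇒≥ λ m<q^ →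
  let M , q∤M , i∣ = commonMultiple pq k (suc i + b) m<q^
      q^∣q^k*M = ∣-trans (∣-trans q^∣ (n∣m*n (suc i))) (leibniz∣ i b (q ^ k * M) i∣)
  in q∤M (*-cancelˡ-∣ (q ^ k) {{m^n≢0 q k {{prime⇒nonZero pq}}}} (subst (_∣ q ^ k * M) (*-comm q (q ^ k)) q^∣q^k*M))

prime∣binomial⇒≤ : ∀ {q} → Prime q → ∀ a b → .{{NonZero a}} → q ∣ (a + b) C a → q ≤ a + b
prime∣binomial⇒≤ {q} pq a b q∣ = subst (_≤ a + b) (*-identityʳ q)
  (prime^∣binomial⇒≤ pq 1 a b (subst (_∣ (a + b) C a) (sym (*-identityʳ q)) q∣))

-- `q` divides `(a + b) !` but neither `a !` nor `b !`.
prime∣binomial : ∀ {q} → Prime q → ∀ a b → a < q → b < q → q ≤ a + b → q ∣ (a + b) C a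
prime∣binomial {q} pq a b a<q b<q q≤a+b
  with euclidsLemma _ (a ! * b !) pq (subst (q ∣_) (sym (binomial-! a b)) (prime∣! pq q≤a+b))
... | inj₁ q∣C = q∣C
... | inj₂ q∣a!b! = contradiction (euclidsLemma (a !) (b !) pq q∣a!b!)
  [ prime∤! pq a<q , prime∤! pq b<q ]′

-- q divides (2 n)! exactly twice and n! once.
prime∤centralBinomial : ∀ {q} → Prime q → 2 < q → ∀ n → q ≤ n → n + n < 3 * q → q ∤ (n + n) C n
prime∤centralBinomial {q} pq 2<q n q≤n 2n<3q q∣C =
  prime^∤! pq 2 (n + n ∸ 2 * q) 2<q r<q (subst (λ m → q ^ 3 ∣ m !) (sym (m+[n∸m]≡n 2q≤2n))
    (subst (q ^ 3 ∣_) (binomial-! n n)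
      (subst (λ s → q * (q * s) ∣ ((n + n) C n) * (n ! * n !)) (sym (*-identityʳ q))
        (*-pres-∣ q∣C (*-pres-∣ q∣n! q∣n!)))))
  where
  q∣n! : q ∣ n !
  q∣n! = prime∣! pq q≤n
  2q≤2n : 2 * q ≤ n + n
  2q≤2n = ≤-trans (≤-reflexive (cong (q +_) (+-identityʳ q))) (+-mono-≤ q≤n q≤n)
  r<q : n + n ∸ 2 * q < q
  r<q = +-cancelˡ-< (2 * q) _ _ (subst (_< 2 * q + q) (sym (m+[n∸m]≡n 2q≤2n))
    (<-≤-trans 2n<3q (≤-reflexive (+-comm q (2 * q)))))

-- Products over intervals and the primorial

∏[_⋯+_] : ℕ → ℕ → (ℕ → ℕ) → ℕ
∏[ a ⋯+ zero  ] g = 1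
∏[ a ⋯+ suc k ] g = g a * ∏[ suc a ⋯+ k ] g

∏-split : ∀ g a k l → ∏[ a ⋯+ k + l ] g ≡ ∏[ a ⋯+ k ] g * ∏[ a + k ⋯+ l ] g
∏-split g a zero    l = trans (cong (λ b → ∏[ b ⋯+ l ] g) (sym (+-identityʳ a))) (sym (*-identityˡ _))
∏-split g a (suc k) l = begin
  g a * ∏[ suc a ⋯+ k + l ] g                               ≡⟨ cong (g a *_) (∏-split g (suc a) k l) ⟩
  g a * (∏[ suc a ⋯+ k ] g * ∏[ suc a + k ⋯+ l ] g)         ≡⟨ *-assoc (g a) _ _ ⟨
  g a * ∏[ suc a ⋯+ k ] g * ∏[ suc a + k ⋯+ l ] g           ≡⟨ cong (λ b → g a * ∏[ suc a ⋯+ k ] g * ∏[ b ⋯+ l ] g) (+-suc a k) ⟨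
  g a * ∏[ suc a ⋯+ k ] g * ∏[ a + suc k ⋯+ l ] g           ∎
  where open ≡-Reasoning

∏-const : ∀ c a k → ∏[ a ⋯+ k ] (λ _ → c) ≡ c ^ k
∏-const c a zero    = refl
∏-const c a (suc k) = cong (c *_) (∏-const c (suc a) k)

primePart : ℕ → ℕ
primePart i with prime? i
... | yes _ = i
... | no  _ = 1

primePart≥1 : ∀ i → 1 ≤ primePart i
primePart≥1 i with prime? i
... | yes pi = <⇒≤ (1<prime pi)
... | no  _  = ≤-refl

primePart-prime : ∀ {q} → Prime q → primePart q ≡ q
primePart-prime {q} pq with prime? q
... | yes _  = refl
... | no ¬pq = contradiction pq ¬pq

∏primePart≥1 : ∀ a k → 1 ≤ ∏[ a ⋯+ k ] primePart
∏primePart≥1 a zero    = ≤-refl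
∏primePart≥1 a (suc k) = *-mono-≤ (primePart≥1 a) (∏primePart≥1 (suc a) k)

-- Divide `N` by its primes in increasing order: a prime above `a` does not divide the prime `a`, so
-- it still divides the quotient.
∏primePart≤ : ∀ k a N → .{{NonZero N}} →
              (∀ {q} → Prime q → a ≤ q → q < a + k → q ∣ N) → ∏[ a ⋯+ k ] primePart ≤ N
∏primePart≤ zero    a (suc N) _ = s≤s z≤n
∏primePart≤ (suc k) a N q∣N with prime? a
... | no _ = subst (_≤ N) (sym (*-identityˡ _)) (∏primePart≤ k (suc a) N
  λ {q} pq a<q q< → q∣N pq (<⇒≤ a<q) (subst (q <_) (sym (+-suc a k)) q<))
... | yes pa = begin
  a * ∏[ suc a ⋯+ k ] primePart ≤⟨ *-monoʳ-≤ a (∏primePart≤ k (suc a) (quotient a∣N) {{quotient≢0 a∣N}} q∣N/a) ⟩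
  a * quotient a∣N              ≡⟨ m∣n⇒n≡m*quotient a∣N ⟨
  N                             ∎
  where
  open ≤-Reasoning
  a∣N = q∣N pa ≤-refl (m<m+n a z<s)
  q∣N/a : ∀ {q} → Prime q → a < q → q < suc a + k → q ∣ quotient a∣N
  q∣N/a {q} pq a<q q<
    with euclidsLemma a (quotient a∣N) pq (subst (q ∣_) (m∣n⇒n≡m*quotient a∣N)
           (q∣N pq (<⇒≤ a<q) (subst (q <_) (sym (+-suc a k)) q<)))
  ... | inj₁ q∣a = contradiction q∣a (>⇒∤ {{prime⇒nonZero pa}} a<q)
  ... | inj₂ q∣  = q∣

primorial : ℕ → ℕ
primorial n = ∏[ 1 ⋯+ n ] primePart

-- As `b ≤ a`, a prime above `a` exceeds both lower parts, so those up to `a + b` all divide the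
-- binomial coefficient.
primorial-+ : ∀ a b → b ≤ a → primorial (a + b) ≤ primorial a * ((a + b) C a)
primorial-+ a b b≤a = begin
  primorial (a + b)                              ≡⟨ ∏-split primePart 1 a b ⟩
  primorial a * ∏[ suc a ⋯+ b ] primePart        ≤⟨ *-monoʳ-≤ (primorial a) (∏primePart≤ b (suc a) _ {{binomial≢0 a b}}
    λ pq a<q q≤a+b → prime∣binomial pq a b a<q (≤-<-trans b≤a a<q) (s≤s⁻¹ q≤a+b)) ⟩
  primorial a * ((a + b) C a)                    ∎
  where open ≤-Reasoning

-- Halve `n`: induction covers the primes up to `⌈ n /2⌉`, the binomial coefficient those above. The
-- exponents match exactly when `n` is odd.
primorial≤4^ : ∀ n → primorial n ≤ 4 ^ n
primorial≤4^ = <-rec (λ n → primorial n ≤ 4 ^ n) go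
  where
  go : ∀ n → (∀ {m} → m < n → primorial m ≤ 4 ^ m) → primorial n ≤ 4 ^ n
  go 0 _ = ≤-refl
  go 1 _ = s≤s z≤n
  go n@(suc (suc k)) rec = begin
    primorial n                        ≡⟨ cong primorial a+b≡n ⟨
    primorial (a + b)                  ≤⟨ primorial-+ a b (⌊n/2⌋≤⌈n/2⌉ n) ⟩
    primorial a * ((a + b) C a)        ≤⟨ *-mono-≤ (rec (⌈n/2⌉<n k)) (≤-reflexive (cong (_C a) a+b≡n)) ⟩
    4 ^ a * (suc (suc k) C a)          ≤⟨ *-monoʳ-≤ (4 ^ a) (binomial≤2^ (suc k) a) ⟩
    4 ^ a * 2 ^ suc k                  ≡⟨ cong (_* 2 ^ suc k) (^-*-assoc 2 2 a) ⟩
    2 ^ (2 * a) * 2 ^ suc k            ≡⟨ ^-distribˡ-+-* 2 (2 * a) (suc k) ⟨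
    2 ^ (2 * a + suc k)                ≤⟨ ^-monoʳ-≤ 2 exponent≤ ⟩
    2 ^ (2 * n)                        ≡⟨ ^-*-assoc 2 2 n ⟨
    4 ^ n                              ∎
    where
    open ≤-Reasoning
    a = ⌈ n /2⌉
    b = ⌊ n /2⌋
    a+b≡n : a + b ≡ n
    a+b≡n = trans (+-comm a b) (⌊n/2⌋+⌈n/2⌉≡n n)
    a≤1+b : a ≤ suc b
    a≤1+b = ⌈n/2⌉-mono {n} {suc n} (n≤1+n n)
    exponent≤ : 2 * a + suc k ≤ 2 * n
    exponent≤ = begin
      2 * a + suc k         ≡⟨ cong (_+ suc k) (cong (a +_) (+-identityʳ a)) ⟩
      a + a + suc k         ≤⟨ +-monoˡ-≤ (suc k) (+-monoʳ-≤ a a≤1+b) ⟩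
      a + suc b + suc k     ≡⟨ cong (_+ suc k) (+-suc a b) ⟩
      suc (a + b) + suc k   ≡⟨ cong (λ m → suc m + suc k) a+b≡n ⟩
      suc n + suc k         ≡⟨ +-suc n (suc k) ⟨
      n + n                 ≡⟨ cong (n +_) (+-identityʳ n) ⟨
      2 * n                 ∎

-- Including `n ≤ a`, where the interval is empty, spares `centralBinomial≤` a comparison of `suc s`
-- with `t`.
∏primePart≤primorial : ∀ a n → ∏[ suc a ⋯+ n ∸ a ] primePart ≤ primorial n
∏primePart≤primorial a n with ≤-total a n
... | inj₂ n≤a rewrite m≤n⇒m∸n≡0 n≤a = ∏primePart≥1 1 n
... | inj₁ a≤n = begin
  ∏[ suc a ⋯+ n ∸ a ] primePart               ≤⟨ m≤n*m _ (primorial a) {{>-nonZero (∏primePart≥1 1 a)}} ⟩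
  primorial a * ∏[ suc a ⋯+ n ∸ a ] primePart ≡⟨ ∏-split primePart 1 a (n ∸ a) ⟨
  primorial (a + (n ∸ a))                     ≡⟨ cong primorial (m+[n∸m]≡n a≤n) ⟩
  primorial n                                 ∎
  where open ≤-Reasoning

-- Sieving the central binomial coefficient

-- Trial division by `a`, ..., `a + k − 1`, removing full powers. The remaining cofactor is rough,
-- so an `a` that divides it is prime and its power is at most `g a`; otherwise the exponent is 0
-- and `1 ≤ g a` suffices.
sift : ∀ g k a N → .{{NonZero N}} → 1 < a → a Rough N → (∀ i → 1 ≤ g i) →
       (∀ {q} → Prime q → a ≤ q → ∀ e → q ^ e ∣ N → q ^ e ≤ g q) →
       ∃ λ N′ → N′ ∣ N × (a + k) Rough N′ × N ≤ ∏[ a ⋯+ k ] g * N′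
sift g zero a N _ rough _ _ =
  N , ∣-refl , subst (_Rough N) (sym (+-identityʳ a)) rough , ≤-reflexive (sym (*-identityˡ N))
sift g (suc k) a N {{N≢0}} 1<a rough g≥1 q^e≤ with valuation 1<a N
... | e , m , eq , a∤m
  with sift g k (suc a) m {{m≢0}} (m<n⇒m<1+n 1<a)
         (∤⇒rough-suc a∤m (rough∧∣⇒rough rough m∣N)) g≥1
         (λ pq a<q e q^e∣m → q^e≤ pq (<⇒≤ a<q) e (∣-trans q^e∣m m∣N))
  where
  m≢0 : NonZero m
  m≢0 = m*n≢0⇒n≢0 (a ^ e) {{subst NonZero eq N≢0}}
  m∣N : m ∣ N
  m∣N = divides (a ^ e) eq
... | N′ , N′∣m , rough′ , m≤ =
  N′ , ∣-trans N′∣m (divides (a ^ e) eq) , subst (_Rough N′) (sym (+-suc a k)) rough′ , (begin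
    N                                    ≡⟨ eq ⟩
    a ^ e * m                            ≤⟨ *-mono-≤ (a^e≤ e (divides m (trans eq (*-comm (a ^ e) m)))) m≤ ⟩
    g a * (∏[ suc a ⋯+ k ] g * N′)       ≡⟨ *-assoc (g a) _ N′ ⟨
    g a * ∏[ suc a ⋯+ k ] g * N′         ∎)
  where
  open ≤-Reasoning
  a^e≤ : ∀ e → a ^ e ∣ N → a ^ e ≤ g a
  a^e≤ zero    _     = g≥1 a
  a^e≤ (suc e) a^e∣N = q^e≤ (rough∧∣⇒prime {{n>1⇒nonTrivial 1<a}} rough (m*n∣⇒m∣ a (a ^ e) a^e∣N))
    ≤-refl (suc e) a^e∣N

centralBinomial≤ : ∀ x .{{_ : NonZero x}} s y → x + x < s * s → Prime y →
                   (∀ {q} → Prime q → x < q → q ≤ x + x → q ≡ y) →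
                   (x + x) C x ≤ (x + x) ^ s * (4 ^ ((x + x) / 3) * (x + x))
centralBinomial≤ x@(suc _) s@(suc _) y m<s² py only-y =
  -- The first sieve runs over the `s` numbers 2, ..., `s + 1`, each contributing at most `m`.
  let N₁ , N₁∣B , rough₁ , B≤ = sift (λ _ → m) s 2 B {{binomial≢0 x x}} (s≤s (s≤s z≤n)) 2-rough
        (λ _ → s≤s z≤n) (λ pq _ e q^e∣B → prime^∣binomial⇒≤ pq e x x q^e∣B)
      instance _ = ∣-nonZero N₁∣B (binomial≢0 x x)
      -- The second runs over `s + 2`, ..., `t`, where primes occur at most once; it is empty if
      -- `t ≤ s + 1`.
      N₂ , N₂∣N₁ , rough₂ , N₁≤ = sift primePart (t ∸ suc s) (2 + s) N₁ (s≤s (s≤s z≤n)) rough₁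
        primePart≥1 (λ pq s<q e q^e∣N₁ → ≤-trans (simple pq s<q e (∣-trans q^e∣N₁ N₁∣B))
                                            (≤-reflexive (sym (primePart-prime pq))))
      N₂∣B = ∣-trans N₂∣N₁ N₁∣B
      -- The lower bound is 1 + max (`s + 1`, `t`), so it yields both `t < q` and `2 + s ≤ q`.
      large : ∀ {q} → Prime q → q ∣ N₂ → 2 + s + (t ∸ suc s) ≤ q
      large pq q∣N₂ = ≮⇒≥ λ q<a → rough₂ (hasNonTrivialDivisor {{prime⇒nonTrivial pq}} q<a q∣N₂)
  in begin
    B                                       ≤⟨ B≤ ⟩
    ∏[ 2 ⋯+ s ] (λ _ → m) * N₁              ≡⟨ cong (_* N₁) (∏-const m 2 s) ⟩
    m ^ s * N₁                              ≤⟨ *-monoʳ-≤ (m ^ s) N₁≤ ⟩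
    m ^ s * (∏[ 2 + s ⋯+ t ∸ suc s ] primePart * N₂)
      ≤⟨ *-monoʳ-≤ (m ^ s) (*-mono-≤
           (≤-trans (∏primePart≤primorial (suc s) t) (primorial≤4^ t))
           (rest≤ N₂ N₂∣B λ pq q∣N₂ →
             ≤-trans (s≤s (m≤n+m∸n t (suc s))) (large pq q∣N₂) ,
             ≤-trans (m≤m+n (2 + s) (t ∸ suc s)) (large pq q∣N₂))) ⟩
    m ^ s * (4 ^ t * m)                     ∎
  where
  open ≤-Reasoning
  m = x + x
  t = m / 3
  B = m C x

  ∣-nonZero : ∀ {a b} → a ∣ b → NonZero b → NonZero a
  ∣-nonZero {suc _} _ _ = _
  ∣-nonZero {zero} 0∣b b≢0 = subst NonZero (0∣⇒≡0 0∣b) b≢0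

  simple : ∀ {q} → Prime q → 2 + s ≤ q → ∀ e → q ^ e ∣ B → q ^ e ≤ q
  simple pq _   0 _ = <⇒≤ (1<prime pq)
  simple {q} pq _ 1 _ = ≤-reflexive (*-identityʳ q)
  simple {q} pq s<q (suc (suc e)) q^e∣B = contradiction
    (≤-<-trans (prime^∣binomial⇒≤ pq (suc (suc e)) x x q^e∣B) m<s²)
    (≤⇒≯ (begin
      s * s             ≤⟨ *-mono-≤ s≤q s≤q ⟩
      q * q             ≡⟨ cong (q *_) (*-identityʳ q) ⟨
      q ^ 2             ≤⟨ ^-monoʳ-≤ q {{prime⇒nonZero pq}} (s≤s (s≤s (z≤n {e}))) ⟩
      q ^ suc (suc e)   ∎))
    where
    s≤q = ≤-trans (m≤n+m s 2) s<q

  t<q⇒m<3q : ∀ {q} → t < q → m < 3 * q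
  t<q⇒m<3q {q} t<q = begin-strict
    m               ≡⟨ m≡m%n+[m/n]*n m 3 ⟩
    m % 3 + t * 3   <⟨ +-monoˡ-< (t * 3) (m%n<n m 3) ⟩
    suc t * 3       ≤⟨ *-monoˡ-≤ 3 t<q ⟩
    q * 3           ≡⟨ *-comm q 3 ⟩
    3 * q           ∎

  -- What survives is a power of `y`: another prime `q` in it would either be at most `x`, against
  -- `prime∤centralBinomial` (`2 < q` since `s` is positive), or lie in (x , 2 x] and equal `y`.
  rest≤ : ∀ N → N ∣ B → (∀ {q} → Prime q → q ∣ N → t < q × 2 + s ≤ q) → N ≤ m
  rest≤ N N∣B large with valuation (1<prime py) N {{∣-nonZero N∣B (binomial≢0 x x)}}
  ... | e , 0 , eq , y∤0 = contradiction (y ∣0) y∤0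
  ... | e , 1 , eq , _ = subst (_≤ m) (sym N≡y^e)
    (prime^∣binomial⇒≤ py e x x (subst (_∣ B) N≡y^e N∣B))
    where
    N≡y^e = trans eq (*-identityʳ (y ^ e))
  ... | e , c@(suc (suc _)) , eq , y∤c with primeDivisor c (s≤s (s≤s z≤n))
  ...   | q , pq , q∣c with large pq (∣-trans q∣c (divides (y ^ e) eq)) | ≤-<-connex q x
  ...     | t<q , 2+s≤q | inj₁ q≤x = contradiction (∣-trans q∣c (∣-trans (divides (y ^ e) eq) N∣B))
    (prime∤centralBinomial pq (≤-trans (s≤s (s≤s (s≤s z≤n))) 2+s≤q) x q≤x (t<q⇒m<3q t<q))
  ...     | _ | inj₂ x<q = contradiction (subst (_∣ c) q≡y q∣c) y∤c
    where
    q≡y = only-y pq x<q (prime∣binomial⇒≤ pq x x (∣-trans q∣c (∣-trans (divides (y ^ e) eq) N∣B)))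

-- Numerical estimates

-- Choosing `s` as a power of two, at most twice the square root of `m`, reduces the final estimate
-- to exponents of 2.
4^-bracket : ∀ m → 1 ≤ m → ∃ λ j → 2 ^ j * 2 ^ j ≤ m × m < 2 ^ suc j * 2 ^ suc j
4^-bracket 1 _ = 0 , ≤-refl , s≤s (s≤s z≤n)
4^-bracket (suc m@(suc _)) _ with 4^-bracket m (s≤s z≤n)
... | j , lower , upper with suc m <? 2 ^ suc j * 2 ^ suc j
...   | yes upper′ = j , m≤n⇒m≤1+n lower , upper′
...   | no  lower′ = suc j , ≮⇒≥ lower′ , ≤-<-trans upper
  (*-mono-< 2^-< 2^-<)
  where
  2^-< = ^-monoʳ-< 2 (s≤s (s≤s z≤n)) (n<1+n (suc j))

-- 7 is the first exponent that works (104 ≤ 128); from there doubling outweighs adding 13.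
13j≤2^ : ∀ k → 13 * suc (k + 7) ≤ 2 ^ (k + 7)
13j≤2^ zero = from-yes (104 ≤? 128)
13j≤2^ (suc k) = begin
  13 * suc (suc k + 7)            ≡⟨ *-suc 13 (suc k + 7) ⟩
  13 + 13 * suc (k + 7)           ≤⟨ +-mono-≤ (≤-trans (m≤m*n 13 (suc (k + 7))) (13j≤2^ k)) (13j≤2^ k) ⟩
  2 ^ (k + 7) + 2 ^ (k + 7)       ≡⟨ cong (2 ^ (k + 7) +_) (+-identityʳ _) ⟨
  2 ^ (suc k + 7)                 ∎
  where open ≤-Reasoning

-- Of the 13 copies of `suc j * u` that fit into `u * u`, the last one absorbs the lower-order term
-- `12 * suc j`.
12j<4^ : ∀ j → 7 ≤ j → 12 * (suc j * suc (2 ^ j)) < 2 ^ j * 2 ^ j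
12j<4^ j 7≤j = begin-strict
  12 * (suc j * suc u)              ≡⟨ expand (suc j) u ⟩
  12 * (suc j * u) + suc j * 12     <⟨ +-monoʳ-< (12 * (suc j * u)) (*-monoʳ-< (suc j) 12<u) ⟩
  12 * (suc j * u) + suc j * u      ≡⟨ collect (suc j) u ⟩
  13 * suc j * u                    ≤⟨ *-monoˡ-≤ u 13j≤u ⟩
  u * u                             ∎
  where
  open ≤-Reasoning
  u = 2 ^ j
  13j≤u : 13 * suc j ≤ u
  13j≤u = subst (λ j → 13 * suc j ≤ 2 ^ j) (m∸n+n≡m 7≤j) (13j≤2^ (j ∸ 7))
  12<u : 12 < u
  12<u = ≤-trans (m≤m*n 13 (suc j)) 13j≤u
  expand : ∀ j u → 12 * (j * suc u) ≡ 12 * (j * u) + j * 12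
  expand = solve-∀
  collect : ∀ j u → 12 * (j * u) + j * u ≡ 13 * j * u
  collect = solve-∀

^-cancelʳ-≤ : ∀ b {m n} → 1 < b → b ^ m ≤ b ^ n → m ≤ n
^-cancelʳ-≤ b 1<b b^m≤b^n = ≮⇒≥ λ n<m → <⇒≱ (^-monoʳ-< b 1<b n<m) b^m≤b^n

-- Two primes between x and 2 x

-- In terms of next primes, so that at `x = p n` it bounds `p (suc (suc n))`.
TwoPrimesBelowDouble : ℕ → Set
TwoPrimesBelowDouble x = ∀ {y z} → y IsNextPrimeAfter x → z IsNextPrimeAfter y → z ≤ x + x

twoPrimes-large : ∀ x → 8192 ≤ x → TwoPrimesBelowDouble x
twoPrimes-large x 8192≤x {y} {z} y-next z-next = ≮⇒≥ impossible
  where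
  open ≤-Reasoning
  m = x + x
  t = m / 3
  instance
    x≢0 : NonZero x
    x≢0 = >-nonZero (≤-trans (s≤s z≤n) 8192≤x)
  -- The threshold 8192 is half of 4 ^ 7: it forces `7 ≤ j`, as `12j<4^` demands.
  4^7≤m : 2 ^ 7 * 2 ^ 7 ≤ m
  4^7≤m = ≤-trans (≤ᵇ⇒≤ (2 ^ 7 * 2 ^ 7) (8192 + 8192) _) (+-mono-≤ {8192} {x} {8192} {x} 8192≤x 8192≤x)
  bracket = 4^-bracket m (≤-trans (s≤s z≤n) 4^7≤m)
  j = proj₁ bracket
  u = 2 ^ j
  s = 2 ^ suc j
  e = suc j + suc j
  u²≤m : u * u ≤ m
  u²≤m = proj₁ (proj₂ bracket)
  m<s² : m < s * s
  m<s² = proj₂ (proj₂ bracket)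
  7≤j : 7 ≤ j
  7≤j = ≮⇒≥ λ j<7 → let s≤2^7 = ^-monoʳ-≤ 2 {suc j} {7} j<7 in
    <⇒≱ m<s² (≤-trans (*-mono-≤ s≤2^7 s≤2^7) 4^7≤m)
  m≤2^e : m ≤ 2 ^ e
  m≤2^e = ≤-trans (<⇒≤ m<s²) (≤-reflexive (sym (^-distribˡ-+-* 2 (suc j) (suc j))))

  impossible : ¬ m < z
  impossible m<z = <⇒≱ (12j<4^ j 7≤j) (≤-trans u²≤m m≤12j)
    where
    only-y : ∀ {q} → Prime q → x < q → q ≤ m → q ≡ y
    only-y pq x<q q≤m with m≤n⇒m<n∨m≡n (least y-next pq x<q)
    ... | inj₁ y<q = contradiction (≤-trans (least z-next pq y<q) q≤m) (<⇒≱ m<z)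
    ... | inj₂ y≡q = sym y≡q
    4^x≤ : 2 ^ (2 * x) ≤ 2 ^ (e + (e * s + (2 * t + e)))
    4^x≤ = begin
      2 ^ (2 * x)                                     ≡⟨ ^-*-assoc 2 2 x ⟨
      4 ^ x                                           ≤⟨ 4^n≤2n*centralBinomial x ⟩
      m * (m C x)                                     ≤⟨ *-monoʳ-≤ m (centralBinomial≤ x s y m<s² (prime y-next) only-y) ⟩
      m * (m ^ s * (4 ^ t * m))                       ≤⟨ *-mono-≤ m≤2^e (*-mono-≤ (^-monoˡ-≤ s m≤2^e) (*-monoʳ-≤ (4 ^ t) m≤2^e)) ⟩
      2 ^ e * ((2 ^ e) ^ s * (4 ^ t * 2 ^ e))         ≡⟨ cong₂ (λ a b → 2 ^ e * (a * (b * 2 ^ e))) (^-*-assoc 2 e s) (^-*-assoc 2 2 t) ⟩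
      2 ^ e * (2 ^ (e * s) * (2 ^ (2 * t) * 2 ^ e))   ≡⟨ cong (λ a → 2 ^ e * (2 ^ (e * s) * a)) (^-distribˡ-+-* 2 (2 * t) e) ⟨
      2 ^ e * (2 ^ (e * s) * 2 ^ (2 * t + e))         ≡⟨ cong (2 ^ e *_) (^-distribˡ-+-* 2 (e * s) (2 * t + e)) ⟨
      2 ^ e * 2 ^ (e * s + (2 * t + e))               ≡⟨ ^-distribˡ-+-* 2 e (e * s + (2 * t + e)) ⟨
      2 ^ (e + (e * s + (2 * t + e)))                 ∎
    -- Compare exponents in `4^x≤` and triple them: the left side becomes `3 * m`, and `6 * t` is at
    -- most `2 * m`, which leaves `m` against the terms from `e` and `e * s`.
    m≤12j : m ≤ 12 * (suc j * suc u)
    m≤12j = +-cancelʳ-≤ (2 * m) _ _ (begin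
      m + 2 * m                                  ≡⟨ triple x ⟩
      3 * (2 * x)                                ≤⟨ *-monoʳ-≤ 3 (^-cancelʳ-≤ 2 {2 * x} {e + (e * s + (2 * t + e))} (s≤s (s≤s z≤n)) 4^x≤) ⟩
      3 * (e + (e * s + (2 * t + e)))            ≡⟨ collect j u t ⟩
      12 * (suc j * suc u) + 2 * (t * 3)         ≤⟨ +-monoʳ-≤ (12 * (suc j * suc u)) (*-monoʳ-≤ 2 (m/n*n≤m m 3)) ⟩
      12 * (suc j * suc u) + 2 * m               ∎)
      where
      triple : ∀ x → x + x + 2 * (x + x) ≡ 3 * (2 * x)
      triple = solve-∀
      collect : ∀ j u t →
        3 * ((suc j + suc j) + ((suc j + suc j) * (2 * u) + (2 * t + (suc j + suc j)))) ≡
        12 * (suc j * suc u) + 2 * (t * 3)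
      collect = solve-∀

TwoPrimesUpTo : ℕ → Set
TwoPrimesUpTo a = ∀ {x} → 6 ≤ x → x < a → TwoPrimesBelowDouble x

-- For `a ≤ x < r₁` the next two primes are at most `r₁` and `r₂`, and `r₂ ≤ a + a ≤ x + x`. The
-- `True` arguments are settled by evaluation at numerals.
extend : ∀ r₁ r₂ {a} → TwoPrimesUpTo a → {_ : True (prime? r₁)} {_ : True (prime? r₂)}
         {_ : True (r₁ <? r₂)} {_ : True (r₂ ≤? a + a)} → TwoPrimesUpTo r₁
extend r₁ r₂ {a} up-to-a {pr₁} {pr₂} {r₁<r₂} {r₂≤2a} {x} 6≤x x<r₁ y-next z-next with ≤-<-connex a x
... | inj₂ x<a = up-to-a 6≤x x<a y-next z-next
... | inj₁ a≤x = ≤-trans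
  (least z-next (toWitness pr₂) (≤-<-trans (least y-next (toWitness pr₁) x<r₁) (toWitness r₁<r₂)))
  (≤-trans (toWitness r₂≤2a) (+-mono-≤ a≤x a≤x))

-- Read from the inside: no `x` satisfies both `6 ≤ x` and `x < 6`, and each pair's larger prime is
-- at most twice the smaller prime of the pair before.
twoPrimes-small : TwoPrimesUpTo 9733
twoPrimes-small =
  extend 9733 9739 (extend 4871 4877 (extend 2441 2447 (extend 1229 1231 (extend 617 619
  (extend 311 313 (extend 157 163 (extend 83 89 (extend 47 53 (extend 29 31 (extend 17 19
  (extend 11 13 (extend 7 11 {6} λ 6≤x x<6 → contradiction 6≤x (<⇒≱ x<6)))))))))))))

twoPrimesBelowDouble : ∀ x → 6 ≤ x → TwoPrimesBelowDouble x
twoPrimesBelowDouble x 6≤x with ≤-<-connex 8192 x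
... | inj₁ 8192≤x = twoPrimes-large x 8192≤x
... | inj₂ x<8192 = twoPrimes-small 6≤x (<-≤-trans x<8192 (from-yes (8192 ≤? 9733)))

-- Sums of consecutive primes

p-< : ∀ n → p n < p (suc n)
p-< n = exceeds (p-isNextPrime n)

6≤p : ∀ n → 4 ≤ n → 6 ≤ p n
6≤p n 4≤n with m≤n⇒m<n∨m≡n 4≤n
6≤p _       _ | inj₂ refl      = from-yes (6 ≤? 7)
6≤p (suc n) _ | inj₁ (s≤s 4≤n) = ≤-trans (6≤p n 4≤n) (<⇒≤ (p-< n))

-- An explicit prime `q` bounds the next prime without evaluating it; this settles `n` = 2 and 3,
-- where `p n < 6`.
p-sum>-from : ∀ n {q} → Prime q → p (suc n) < q × q < p n + p (suc n) →
              p (suc (suc n)) < p n + p (suc n)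
p-sum>-from n pq (p<q , q<sum) = ≤-<-trans (least (p-isNextPrime (suc n)) pq p<q) q<sum

p-sum>-large : ∀ n → 6 ≤ p n → p (suc (suc n)) < p n + p (suc n)
p-sum>-large n 6≤pn = ≤-<-trans
  (twoPrimesBelowDouble (p n) 6≤pn (p-isNextPrime n) (p-isNextPrime (suc n)))
  (+-monoʳ-< (p n) (p-< n))

-- Case distinctions go through [_,_]′ and equations through subst: with and rewrite would normalise
-- the goal, and already p 5 is out of reach, as p finds it by factorising 7 ! + 1.
p-sum> : ∀ n → 2 ≤ n → p (suc (suc n)) < p n + p (suc n)
p-sum> n 2≤n = [ [ p-sum>-large n ∘ 6≤p n , at-3 ]′ ∘ m≤n⇒m<n∨m≡n , at-2 ]′ (m≤n⇒m<n∨m≡n 2≤n)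
  where
  at-2 : 2 ≡ n → p (suc (suc n)) < p n + p (suc n)
  at-2 2≡n = p-sum>-from n (from-yes (prime? 7))
    (subst (λ n → p (suc n) < 7 × 7 < p n + p (suc n)) 2≡n
      (from-yes (5 <? 7) , from-yes (7 <? 8)))

  at-3 : 3 ≡ n → p (suc (suc n)) < p n + p (suc n)
  at-3 3≡n = p-sum>-from n (from-yes (prime? 11))
    (subst (λ n → p (suc n) < 11 × 11 < p n + p (suc n)) 3≡n
      (from-yes (7 <? 11) , from-yes (11 <? 12)))

theorem2 : (n : ℕ) → n ≥ 2 →
    (p (n ∸ 1) + p n ≥ p (n + 1)) × (p (n ∸ 1) + p n ≡ p (n + 1) ⇔ n ≡ 2)
theorem2 n n≥2 =
  [ <⇒≤ ∘ strict , ≤-reflexive ∘ sym ∘ equality ∘ sym ]′ cases ,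
  mk⇔ (λ sum≡ → [ (λ 3≤n → contradiction (sym sum≡) (<⇒≢ (strict 3≤n))) , sym ]′ cases) equality
  where
  cases = m≤n⇒m<n∨m≡n n≥2

  equality : n ≡ 2 → p (n ∸ 1) + p n ≡ p (n + 1)
  -- At `n = 2` both sides evaluate to 5.
  equality n≡2 = subst (λ n → p (n ∸ 1) + p n ≡ p (n + 1)) (sym n≡2) refl

  strict : 3 ≤ n → p (n + 1) < p (n ∸ 1) + p n
  strict 3≤n = subst₂ (λ i j → p i < p (n ∸ 1) + p j)
    (trans (cong suc 1+[n∸1]≡n) (+-comm 1 n)) 1+[n∸1]≡n (p-sum> (n ∸ 1) (∸-monoˡ-≤ 1 3≤n))
    where
    1+[n∸1]≡n : suc (n ∸ 1) ≡ n
    1+[n∸1]≡n = m+[n∸m]≡n (<⇒≤ n≥2)
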